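{- If $\mathcal{A}$ is an $R$-competitive incremental algorithm for frequency allocation on bipartite graphs, then $R \ge 10/7$.
   Context: Frequency allocation: a (possibly infinite) undirected graph $G$ is given, and requests for frequencies (positive integers) arrive at its vertices. The load $\ell_v$ of a vertex $v$ is the number of requests at $v$. A frequency allocation assigns to each vertex $v$ a set $L_v$ of frequencies with $|L_v| = \ell_v$ and $L_v \cap L_w = \emptyset$ for every edge $(v,w)$. The number of frequencies used is $|\bigcup_v L_v|$, and $\mathrm{opt}(G,\bar\ell)$ denotes the minimum possible number for load vector $\bar\ell$. In the incremental version, requests arrive one at a time, and the algorithm must irrevocably assign to each request, upon its arrival, a frequency, so that at all times frequencies of distinct requests at the same vertex differ and frequencies at adjacent vertices differ. An incremental algorithm is $R$-competitive for bipartite graphs if there is a constant $\lambda$ (independent of the graph and of the requests) such that for every bipartite graph $G$ and every finite sequence of requests, the total number of distinct frequencies used by the algorithm is at most $R\cdot \mathrm{opt}(G,\bar\ell) + \lambda$, where $\bar\ell$ is the resulting load vector. -}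

module Defs where

open import Data.Nat using (ℕ)
import Data.Nat.Properties as ℕP
open import Data.Bool using (Bool)
open import Data.Fin using (Fin; toℕ)
open import Data.List using (List; length; lookup; take; tabulate; deduplicate)
open import Data.Sum using (_⊎_)
open import Data.Product using (∃)
open import Data.Integer using (+_)
open import Data.Rational using (ℚ; _≤_; _*_; _+_; _/_)
open import Relation.Binary.PropositionalEquality using (_≡_; _≢_)

record BipartiteGraph : Set₁ where
  field
    V         : Set
    E         : V → V → Set
    E-sym     : ∀ {v w} → E v w → E w v
    side      : V → Bool
    bipartite : ∀ {v w} → E v w → side v ≢ side w
open BipartiteGraph public

ℕ→ℚ : ℕ → ℚ
ℕ→ℚ n = (+ n) / 1

#freqs : ∀ {n} → (Fin n → ℕ) → ℕ
#freqs f = length (deduplicate ℕP._≟_ (tabulate f))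

-- A finite request sequence rs (list of vertices, request i arrives at vertex
-- lookup rs i) and an assignment f of a frequency to each request is a
-- frequency allocation iff distinct requests at the same vertex, or at
-- adjacent vertices, get distinct frequencies.
-- (L_v = { f i | request i is at v }.)
IsAllocation : (G : BipartiteGraph) (rs : List (V G)) → (Fin (length rs) → ℕ) → Set
IsAllocation G rs f =
  ∀ i j → i ≢ j → (lookup rs i ≡ lookup rs j ⊎ E G (lookup rs i) (lookup rs j)) → f i ≢ f j

-- A deterministic incremental algorithm: knowing the graph, the previous
-- requests (its own earlier answers are determined by them) and the vertex of
-- the new request, it irrevocably picks a frequency.
IncrementalAlgorithm : Set₁
IncrementalAlgorithm = (G : BipartiteGraph) → List (V G) → V G → ℕ

run : (A : IncrementalAlgorithm) (G : BipartiteGraph) (rs : List (V G)) → Fin (length rs) → ℕ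
run A G rs i = A G (take (toℕ i) rs) (lookup rs i)

IsValidAlgorithm : IncrementalAlgorithm → Set₁
IsValidAlgorithm A = ∀ (G : BipartiteGraph) (rs : List (V G)) → IsAllocation G rs (run A G rs)

-- R-competitive: ∃ constant c, ∀ bipartite G, ∀ finite request sequence,
-- #freqs used ≤ R · opt + c.  "≤ R·opt + c" is unfolded as "≤ R·k + c for every
-- allocation using k frequencies" (opt is the minimum such k, which is attained).
IsCompetitive : ℚ → IncrementalAlgorithm → Set₁
IsCompetitive R A =
  ∃ λ (c : ℚ) → ∀ (G : BipartiteGraph) (rs : List (V G)) (f : Fin (length rs) → ℕ) →
    IsAllocation G rs f →
    ℕ→ℚ (#freqs (run A G rs)) ≤ R * ℕ→ℚ (#freqs f) + c

{-# OPTIONS --safe #-}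

-- The adversary uses one fixed graph: a vertex with a time t and a load l receives its l requests
-- at time t, and vertices (t , l), (t′ , l′) on opposite sides are adjacent iff l + l′ ≤ max t t′.
-- Then opt ≤ T after time T, and adjacent vertices hold disjoint frequency sets.  Let A, B be the
-- sets of the two vertices with label (t , l), one on each side, and for s = 2h put
--   Z_s = (A(s, s) ∩ B(s, s)) ∪ (A(3s/2, s) ∩ B(3s/2, s)).
-- Writing U_T for the set of frequencies used by time T, a case analysis on single frequencies gives
--   2 Z_s + [A + B](2s, s) + [A + B](2s, 2s) + [A + B](3s, 2s) ≤ 2 U_{2s} + U_{3s} + Z_{2s}
-- for indicator functions, hence 2 |Z_s| + 10 s ≤ (7 R s + O(1)) + |Z_{2s}|.  If R < 10/7, then
-- |Z_s| / s grows by a fixed positive amount at each doubling of s, contradicting |Z_s| ≤ 2 s.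

module Submission where

open import Defs
open import Algebra.Properties.CommutativeSemigroup using (interchange)
open import Data.Bool using (Bool; true; false; _∧_; _∨_; not)
import Data.Bool.Properties as Boolₚ
open import Data.Fin using (Fin; zero; suc; toℕ)
open import Data.Integer as ℤ using (+_)
import Data.Integer.Properties as ℤₚ
open import Data.Integer.Tactic.RingSolver using () renaming (solve-∀ to ℤ-solve-∀)
open import Data.List using (List; []; _∷_; _++_; _∷ʳ_; length; lookup; map; replicate; tabulate; take; deduplicate)
open import Data.List.Extrema.Nat using (max; xs≤max)
open import Data.List.Membership.Propositional using (_∈_; _∉_)
open import Data.List.Membership.Propositional.Properties
open import Data.List.Properties
open import Data.List.Relation.Unary.All as All using (All; []; _∷_)
import Data.List.Relation.Unary.All.Properties as All
open import Data.List.Relation.Unary.AllPairs using (AllPairs; []; _∷_)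
import Data.List.Relation.Unary.AllPairs.Properties as AllPairs
open import Data.List.Relation.Unary.Any using (here; there)
open import Data.List.Relation.Unary.Unique.Propositional using (Unique)
open import Data.Nat using (ℕ; zero; suc; _+_; _*_; _∸_; _≤_; _<_; _⊔_; _≤′_; ≤′-refl; ≤′-step; z≤n; s≤s; _≟_; _≤?_; NonZero; >-nonZero)
open import Data.Nat.Properties
open import Data.Nat.Tactic.RingSolver using (solve-∀)
open import Data.List.Membership.DecPropositional _≟_ using (_∈?_)
open import Data.List.Relation.Unary.Unique.DecPropositional.Properties _≟_ using (deduplicate-!)
open import Data.Product using (∃; _×_; _,_; proj₁; proj₂)
open import Data.Rational as ℚ using (ℚ; mkℚ; ↥_; ↧ₙ_; toℚᵘ)
import Data.Rational.Properties as ℚₚ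
import Data.Rational.Unnormalised as ℚᵘ
import Data.Rational.Unnormalised.Properties as ℚᵘₚ
open import Data.Sum using (_⊎_; inj₁; inj₂)
open import Function using (_∘_)
open import Relation.Binary.PropositionalEquality
open import Relation.Nullary using (Dec; yes; no; does; ¬_; contradiction)
open import Relation.Nullary.Decidable using (map′; _→-dec_; _×-dec_; dec-true; dec-false; from-yes)

-- Finite sums and cardinalities

Σ< : ℕ → (ℕ → ℕ) → ℕ
Σ< zero    f = 0
Σ< (suc n) f = Σ< n f + f n

Σ<-cong : ∀ {f g} n → (∀ x → f x ≡ g x) → Σ< n f ≡ Σ< n g
Σ<-cong zero    f≗g = refl
Σ<-cong (suc n) f≗g = cong₂ _+_ (Σ<-cong n f≗g) (f≗g n)

Σ<-mono : ∀ {f g} n → (∀ x → f x ≤ g x) → Σ< n f ≤ Σ< n g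
Σ<-mono zero    f≤g = z≤n
Σ<-mono (suc n) f≤g = +-mono-≤ (Σ<-mono n f≤g) (f≤g n)

Σ<-+ : ∀ n f g → Σ< n (λ x → f x + g x) ≡ Σ< n f + Σ< n g
Σ<-+ zero    f g = refl
Σ<-+ (suc n) f g = trans (cong (_+ (f n + g n)) (Σ<-+ n f g))
                         (interchange +-commutativeSemigroup (Σ< n f) (Σ< n g) (f n) (g n))

Σ<-const : ∀ n k → Σ< n (λ _ → k) ≡ n * k
Σ<-const zero    k = refl
Σ<-const (suc n) k = trans (cong (_+ k) (Σ<-const n k)) (+-comm (n * k) k)

𝟙 : Bool → ℕ
𝟙 false = 0
𝟙 true  = 1

𝟙≤1 : ∀ b → 𝟙 b ≤ 1
𝟙≤1 false = z≤n
𝟙≤1 true  = s≤s z≤n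

Σ<-δ-≥ : ∀ n {y} → n ≤ y → Σ< n (λ x → 𝟙 (does (x ≟ y))) ≡ 0
Σ<-δ-≥ zero    n≤y = refl
Σ<-δ-≥ (suc n) {y} n<y rewrite dec-false (n ≟ y) (<⇒≢ n<y) =
  trans (+-identityʳ _) (Σ<-δ-≥ n (<⇒≤ n<y))

Σ<-δ-< : ∀ n {y} → y < n → Σ< n (λ x → 𝟙 (does (x ≟ y))) ≡ 1
Σ<-δ-< (suc n) {y} y<1+n with n ≟ y
... | yes refl rewrite dec-true (y ≟ y) refl = cong (_+ 1) (Σ<-δ-≥ n ≤-refl)
... | no  n≢y rewrite dec-false (n ≟ y) n≢y =
  trans (+-identityʳ _) (Σ<-δ-< n (≤∧≢⇒< (≤-pred y<1+n) (n≢y ∘ sym)))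

_∈ᵇ_ : ℕ → List ℕ → Bool
x ∈ᵇ xs = does (x ∈? xs)

∈ᵇ-cong : ∀ x {xs ys} → (x ∈ xs → x ∈ ys) → (x ∈ ys → x ∈ xs) → (x ∈ᵇ xs) ≡ (x ∈ᵇ ys)
∈ᵇ-cong x {xs} {ys} to from with x ∈? ys
... | yes x∈ys = dec-true  (x ∈? xs) (from x∈ys)
... | no  x∉ys = dec-false (x ∈? xs) (x∉ys ∘ to)

∈ᵇ-disjoint : ∀ x {xs ys} → (x ∈ xs → x ∉ ys) → (x ∈ᵇ xs) ∧ (x ∈ᵇ ys) ≡ false
∈ᵇ-disjoint x {xs} {ys} disj with x ∈? xs
... | yes x∈xs = dec-false (x ∈? ys) (disj x∈xs)
... | no  _    = refl

∈ᵇ-⊆ : ∀ x {xs ys} → (x ∈ xs → x ∈ ys) → (x ∈ᵇ xs) ∧ not (x ∈ᵇ ys) ≡ false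
∈ᵇ-⊆ x {xs} {ys} sub with x ∈? xs
... | yes x∈xs = cong not (dec-true (x ∈? ys) (sub x∈xs))
... | no  _    = refl

-- Cardinality as a sum of indicators below a cutoff: an inequality checked for each single
-- frequency can then be summed with `Σ<-mono`.
∣_∣<_ : (ℕ → Bool) → ℕ → ℕ
∣ p ∣< n = Σ< n (𝟙 ∘ p)

𝟙-∈ᵇ-∷ : ∀ x {y ys} → y ∉ ys → 𝟙 (x ∈ᵇ (y ∷ ys)) ≡ 𝟙 (does (x ≟ y)) + 𝟙 (x ∈ᵇ ys)
𝟙-∈ᵇ-∷ x {y} {ys} y∉ys with x ≟ y
... | yes refl rewrite dec-true (x ≟ x) refl | dec-false (x ∈? ys) y∉ys = refl
... | no  x≢y  rewrite dec-false (x ≟ y) x≢y = refl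

∣Unique∣ : ∀ n {xs} → Unique xs → All (_< n) xs → ∣ _∈ᵇ xs ∣< n ≡ length xs
∣Unique∣ n [] [] = trans (Σ<-const n 0) (*-zeroʳ n)
∣Unique∣ n {y ∷ ys} (y≢ ∷ uniq) (y<n ∷ ys<n) = begin
  ∣ _∈ᵇ (y ∷ ys) ∣< n                                      ≡⟨ Σ<-cong n (λ x → 𝟙-∈ᵇ-∷ x (λ y∈ → All.lookup y≢ y∈ refl)) ⟩
  Σ< n (λ x → 𝟙 (does (x ≟ y)) + 𝟙 (x ∈ᵇ ys))              ≡⟨ Σ<-+ n _ _ ⟩
  Σ< n (λ x → 𝟙 (does (x ≟ y))) + ∣ _∈ᵇ ys ∣< n            ≡⟨ cong₂ _+_ (Σ<-δ-< n y<n) (∣Unique∣ n uniq ys<n) ⟩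
  1 + length ys                                            ∎
  where open ≡-Reasoning

∣deduplicate∣ : ∀ n xs → All (_< n) xs → ∣ _∈ᵇ xs ∣< n ≡ length (deduplicate _≟_ xs)
∣deduplicate∣ n xs xs<n = trans
  (Σ<-cong n (λ x → cong 𝟙 (∈ᵇ-cong x (∈-deduplicate⁺ _≟_) (∈-deduplicate⁻ _≟_ xs))))
  (∣Unique∣ n (deduplicate-! xs) (All.tabulate (All.lookup xs<n ∘ ∈-deduplicate⁻ _≟_ xs)))

length-deduplicate-≤ : ∀ n xs → All (_< n) xs → length (deduplicate _≟_ xs) ≤ n
length-deduplicate-≤ n xs xs<n = begin
  length (deduplicate _≟_ xs) ≡⟨ ∣deduplicate∣ n xs xs<n ⟨
  ∣ _∈ᵇ xs ∣< n               ≤⟨ Σ<-mono n (λ x → 𝟙≤1 (x ∈ᵇ xs)) ⟩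
  Σ< n (λ _ → 1)              ≡⟨ Σ<-const n 1 ⟩
  n * 1                       ≡⟨ *-identityʳ n ⟩
  n                           ∎
  where open ≤-Reasoning

-- Rational arithmetic

toℚᵘ-ℕ→ℚ : ∀ n → toℚᵘ (ℕ→ℚ n) ℚᵘ.≃ ℚᵘ.mkℚᵘ (+ n) 0
toℚᵘ-ℕ→ℚ n = ℚₚ.toℚᵘ-fromℚᵘ (ℚᵘ.mkℚᵘ (+ n) 0)

-- The denominator is at least 1. This replaces the additive constant by a natural number, so that
-- the counting can take place in `ℕ`.
≤ℕ→ℚ∣↥∣ : ∀ c → c ℚ.≤ ℕ→ℚ ℤ.∣ ↥ c ∣
≤ℕ→ℚ∣↥∣ (mkℚ n d-1 _) = ℚₚ.toℚᵘ-cancel-≤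
  (ℚᵘₚ.≤-respʳ-≃ (ℚᵘₚ.≃-sym (toℚᵘ-ℕ→ℚ ℤ.∣ n ∣)) (ℚᵘ.*≤* (n≤∣n∣d n d-1)))
  where
  n≤∣n∣d : ∀ n d-1 → n ℤ.* + 1 ℤ.≤ + ℤ.∣ n ∣ ℤ.* + suc d-1
  n≤∣n∣d (+ n) d-1 = subst₂ ℤ._≤_ (ℤₚ.pos-* n 1) (ℤₚ.pos-* n (suc d-1))
    (ℤ.+≤+ (*-monoʳ-≤ n (s≤s (z≤n {d-1}))))
  n≤∣n∣d ℤ.-[1+ n ] d-1 = ℤₚ.≤-trans (ℤₚ.≤-reflexive (ℤₚ.*-identityʳ ℤ.-[1+ n ])) ℤ.-≤+

-- Here R = p / B. Over the integers the strict inequality 7p < 10B improves to 7p + 1 ≤ 10B;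
-- multiplied by `K`, the extra 1 is the lone `K` on the left. This slack drives the growth of Z.
clear-denominators-ℤ : ∀ p U K C B .{{_ : ℤ.NonNegative K}} →
  U ℤ.* B ℤ.≤ p ℤ.* K ℤ.+ C ℤ.* B → p ℤ.* + 7 ℤ.< + 10 ℤ.* B →
  + 7 ℤ.* B ℤ.* U ℤ.+ K ℤ.≤ + 10 ℤ.* B ℤ.* K ℤ.+ + 7 ℤ.* B ℤ.* C
clear-denominators-ℤ p U K C B UB≤ p7<10B = begin
  + 7 ℤ.* B ℤ.* U ℤ.+ K                                  ≡⟨ regroupˡ U K B ⟩
  + 7 ℤ.* (U ℤ.* B) ℤ.+ K                                ≤⟨ ℤₚ.+-monoˡ-≤ K (ℤₚ.*-monoˡ-≤-nonNeg (+ 7) UB≤) ⟩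
  + 7 ℤ.* (p ℤ.* K ℤ.+ C ℤ.* B) ℤ.+ K                    ≡⟨ regroupʳ p K C B ⟩
  (+ 1 ℤ.+ p ℤ.* + 7) ℤ.* K ℤ.+ + 7 ℤ.* B ℤ.* C          ≤⟨ ℤₚ.+-monoˡ-≤ _ (ℤₚ.*-monoʳ-≤-nonNeg K (ℤₚ.i<j⇒suc[i]≤j p7<10B)) ⟩
  + 10 ℤ.* B ℤ.* K ℤ.+ + 7 ℤ.* B ℤ.* C                   ∎
  where
  open ℤₚ.≤-Reasoning
  regroupˡ : ∀ U K B → + 7 ℤ.* B ℤ.* U ℤ.+ K ≡ + 7 ℤ.* (U ℤ.* B) ℤ.+ K
  regroupˡ = ℤ-solve-∀
  regroupʳ : ∀ p K C B → + 7 ℤ.* (p ℤ.* K ℤ.+ C ℤ.* B) ℤ.+ K ≡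
                         (+ 1 ℤ.+ p ℤ.* + 7) ℤ.* K ℤ.+ + 7 ℤ.* B ℤ.* C
  regroupʳ = ℤ-solve-∀

clear-denominators : ∀ R c u k → R ℚ.< + 10 ℚ./ 7 → ℕ→ℚ u ℚ.≤ R ℚ.* ℕ→ℚ k ℚ.+ c →
  7 * ↧ₙ R * u + k ≤ 10 * ↧ₙ R * k + 7 * ↧ₙ R * ℤ.∣ ↥ c ∣
clear-denominators R@(mkℚ p b-1 _) c u k R<10/7 u≤ =
  ℤₚ.drop‿+≤+ (subst₂ ℤ._≤_ (pos-lhs b u k) (pos-rhs b k C)
    (clear-denominators-ℤ p (+ u) (+ k) (+ C) (+ b) uz (ℚₚ.drop-*<* R<10/7)))
  where
  b = suc b-1
  C = ℤ.∣ ↥ c ∣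
  pos-lhs : ∀ b u k → + 7 ℤ.* + b ℤ.* + u ℤ.+ + k ≡ + (7 * b * u + k)
  pos-lhs b u k rewrite sym (ℤₚ.pos-* 7 b) | sym (ℤₚ.pos-* (7 * b) u) = refl
  pos-rhs : ∀ b k C → + 10 ℤ.* + b ℤ.* + k ℤ.+ + 7 ℤ.* + b ℤ.* + C ≡ + (10 * b * k + 7 * b * C)
  pos-rhs b k C rewrite sym (ℤₚ.pos-* 10 b) | sym (ℤₚ.pos-* (10 * b) k)
                      | sym (ℤₚ.pos-* 7 b) | sym (ℤₚ.pos-* (7 * b) C) = refl
  u≤ᵘ : ℚᵘ.mkℚᵘ (+ u) 0 ℚᵘ.≤ toℚᵘ R ℚᵘ.* ℚᵘ.mkℚᵘ (+ k) 0 ℚᵘ.+ ℚᵘ.mkℚᵘ (+ C) 0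
  u≤ᵘ = ℚᵘₚ.≤-respˡ-≃ (toℚᵘ-ℕ→ℚ u) (ℚᵘₚ.≤-respʳ-≃
    (ℚᵘₚ.≃-trans (ℚₚ.toℚᵘ-homo-+ (R ℚ.* ℕ→ℚ k) (ℕ→ℚ C))
      (ℚᵘₚ.+-cong
        (ℚᵘₚ.≃-trans (ℚₚ.toℚᵘ-homo-* R (ℕ→ℚ k)) (ℚᵘₚ.*-congˡ {toℚᵘ R} (toℚᵘ-ℕ→ℚ k)))
        (toℚᵘ-ℕ→ℚ C)))
    (ℚₚ.toℚᵘ-mono-≤ (ℚₚ.≤-trans u≤ (ℚₚ.+-monoʳ-≤ (R ℚ.* ℕ→ℚ k) (≤ℕ→ℚ∣↥∣ c)))))
  uz : + u ℤ.* + b ℤ.≤ p ℤ.* + k ℤ.+ + C ℤ.* + b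
  uz = subst₂ ℤ._≤_ (cong (λ x → + u ℤ.* + x) b*1*1≡b)
         (trans (ℤₚ.*-identityʳ _) (cong₂ ℤ._+_ (ℤₚ.*-identityʳ (p ℤ.* + k))
                                                (cong (λ x → + C ℤ.* + x) (*-identityʳ b))))
         (ℚᵘₚ.drop-*≤* u≤ᵘ)
    where
    b*1*1≡b : b * 1 * 1 ≡ b
    b*1*1≡b = trans (*-identityʳ (b * 1)) (*-identityʳ b)

-- Request logs

module _ {V : Set} (a : List V → V → ℕ) where

  -- An index-free form of `run`: each request is paired with its answer. The accumulator `past` is
  -- what lets the log of an append split into two logs.
  log : List V → List V → List (V × ℕ)
  log past []       = []
  log past (v ∷ vs) = (v , a past v) ∷ log (past ∷ʳ v) vs

  log-++ : ∀ past vs ws → log past (vs ++ ws) ≡ log past vs ++ log (past ++ vs) ws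
  log-++ past []       ws = cong (λ p → log p ws) (sym (++-identityʳ past))
  log-++ past (v ∷ vs) ws = cong ((v , a past v) ∷_)
    (trans (log-++ (past ∷ʳ v) vs ws)
           (cong (λ p → log (past ∷ʳ v) vs ++ log p ws) (∷ʳ-++ past v vs)))

  length-log : ∀ past vs → length (log past vs) ≡ length vs
  length-log past []       = refl
  length-log past (v ∷ vs) = cong suc (length-log (past ∷ʳ v) vs)

  ∈-log-replicate : ∀ past n v {x} → x ∈ map proj₂ (log past (replicate n v)) →
    (v , x) ∈ log past (replicate n v)
  ∈-log-replicate past (suc n) v (here refl) = here refl
  ∈-log-replicate past (suc n) v (there x∈)  = there (∈-log-replicate (past ∷ʳ v) n v x∈)

  tabulate-log : ∀ past vs →
    tabulate (λ i → lookup vs i , a (past ++ take (toℕ i) vs) (lookup vs i)) ≡ log past vs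
  tabulate-log past []       = refl
  tabulate-log past (v ∷ vs) = cong₂ _∷_
    (cong (λ p → v , a p v) (++-identityʳ past))
    (trans (tabulate-cong (λ i → cong (λ p → lookup vs i , a p (lookup vs i))
                                      (sym (∷ʳ-++ past v (take (toℕ i) vs)))))
           (tabulate-log (past ∷ʳ v) vs))

module _ (G : BipartiteGraph) where

  Compatible : V G × ℕ → V G × ℕ → Set
  Compatible (v , x) (w , y) = v ≡ w ⊎ E G v w → x ≢ y

  Compatible-sym : ∀ {p q} → Compatible p q → Compatible q p
  Compatible-sym pq (inj₁ w≡v) y≡x = pq (inj₁ (sym w≡v)) (sym y≡x)
  Compatible-sym pq (inj₂ Ewv) y≡x = pq (inj₂ (E-sym G Ewv)) (sym y≡x)

  assignment : (ps : List (V G × ℕ)) → Fin (length (map proj₁ ps)) → ℕ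
  assignment (p ∷ ps) zero    = proj₂ p
  assignment (p ∷ ps) (suc i) = assignment ps i

  tabulate-assignment : ∀ ps → tabulate (assignment ps) ≡ map proj₂ ps
  tabulate-assignment []       = refl
  tabulate-assignment (p ∷ ps) = cong (proj₂ p ∷_) (tabulate-assignment ps)

  All-Compatible : ∀ p ps → All (Compatible p) ps →
    ∀ i → Compatible p (lookup (map proj₁ ps) i , assignment ps i)
  All-Compatible p (q ∷ ps) (pq ∷ _) zero    = pq
  All-Compatible p (q ∷ ps) (_ ∷ pc) (suc i) = All-Compatible p ps pc i

  assignment-isAllocation : ∀ ps → AllPairs Compatible ps →
    IsAllocation G (map proj₁ ps) (assignment ps)
  assignment-isAllocation (p ∷ ps) (pc ∷ cs) zero    zero    i≢j = contradiction refl i≢j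
  assignment-isAllocation (p ∷ ps) (pc ∷ cs) zero    (suc j) i≢j = All-Compatible p ps pc j
  assignment-isAllocation (p ∷ ps) (pc ∷ cs) (suc i) zero    i≢j =
    Compatible-sym {p} {lookup (map proj₁ ps) i , assignment ps i} (All-Compatible p ps pc i)
  assignment-isAllocation (p ∷ ps) (pc ∷ cs) (suc i) (suc j) i≢j =
    assignment-isAllocation ps cs i j (i≢j ∘ cong suc)

module _ (A : IncrementalAlgorithm) (G : BipartiteGraph) where

  runLog : List (V G) → List (V G × ℕ)
  runLog = log (A G) []

  #freqs-run : ∀ rs → #freqs (run A G rs) ≡ length (deduplicate _≟_ (map proj₂ (runLog rs)))
  #freqs-run rs = cong (length ∘ deduplicate _≟_)
    (trans (sym (map-tabulate (λ i → lookup rs i , run A G rs i) proj₂))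
           (cong (map proj₂) (tabulate-log (A G) [] rs)))

  runLog-compatible : IsValidAlgorithm A → ∀ rs → AllPairs (Compatible G) (runLog rs)
  runLog-compatible valid rs = subst (AllPairs (Compatible G)) (tabulate-log (A G) [] rs)
    (AllPairs.tabulate⁺ (λ {i} {j} → valid G rs i j))

  runLog-conflict : IsValidAlgorithm A → ∀ rs {v w x y} → (v , x) ∈ runLog rs → (w , y) ∈ runLog rs →
    E G v w → x ≢ y
  runLog-conflict valid rs vx∈ wy∈ Evw
    with i , refl ← ∈-tabulate⁻ (subst (_ ∈_) (sym (tabulate-log (A G) [] rs)) vx∈)
       | j , refl ← ∈-tabulate⁻ (subst (_ ∈_) (sym (tabulate-log (A G) [] rs)) wy∈)
    -- Equal indices would put both ends of the edge at one vertex, hence on one side.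
    = valid G rs i j (λ { refl → bipartite G Evw refl }) (inj₂ Evw)

AllPairs-++⁻ʳ : ∀ {X : Set} {_~_ : X → X → Set} xs {ys} → AllPairs _~_ (xs ++ ys) → AllPairs _~_ ys
AllPairs-++⁻ʳ []       ps       = ps
AllPairs-++⁻ʳ (x ∷ xs) (_ ∷ ps) = AllPairs-++⁻ʳ xs ps

-- The adversary's graph

module Adversary (time load : ℕ → ℕ)
  (time-mono : ∀ {j k} → j ≤ k → time j ≤ time k) (load≤time : ∀ k → load k ≤ time k) where

  -- Vertex (c , k) lies on side c and receives `load k` requests in step k, at time `time k`.
  graph : BipartiteGraph
  graph = record
    { V         = Bool × ℕ
    ; E         = λ (c , j) (d , k) → c ≢ d × load j + load k ≤ time (j ⊔ k)
    ; E-sym     = λ {(_ , j)} {(_ , k)} (c≢d , l≤t) →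
        c≢d ∘ sym , subst₂ _≤_ (+-comm (load j) (load k)) (cong time (⊔-comm j k)) l≤t
    ; side      = proj₁
    ; bipartite = proj₁
    }

  block : Bool → ℕ → List (Bool × ℕ)
  block c k = replicate (load k) (c , k)

  requests : ℕ → List (Bool × ℕ)
  requests zero    = []
  requests (suc n) = (requests n ++ block true n) ++ block false n

  -- Side `true` fills the frequencies below t upwards from 0, side `false` downwards from t.
  optBlock : ℕ → Bool → ℕ → ℕ → List ((Bool × ℕ) × ℕ)
  optBlock t c     k zero    = []
  optBlock t true  k (suc j) = ((true , k) , j) ∷ optBlock t true k j
  optBlock t false k (suc j) = ((false , k) , t ∸ suc j) ∷ optBlock t false k j

  optLog : ℕ → ℕ → List ((Bool × ℕ) × ℕ)
  optLog t zero    = []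
  optLog t (suc n) = (optLog t n ++ optBlock t true n (load n)) ++ optBlock t false n (load n)

  optBlock-requests : ∀ t c k j → map proj₁ (optBlock t c k j) ≡ replicate j (c , k)
  optBlock-requests t c     k zero    = refl
  optBlock-requests t true  k (suc j) = cong (_ ∷_) (optBlock-requests t true k j)
  optBlock-requests t false k (suc j) = cong (_ ∷_) (optBlock-requests t false k j)

  optLog-requests : ∀ t n → map proj₁ (optLog t n) ≡ requests n
  optLog-requests t zero    = refl
  optLog-requests t (suc n) = trans (map-++ proj₁ (optLog t n ++ optBlock t true n (load n)) _)
    (cong₂ _++_
      (trans (map-++ proj₁ (optLog t n) _)
             (cong₂ _++_ (optLog-requests t n) (optBlock-requests t true n (load n))))
      (optBlock-requests t false n (load n)))

  -- The intervals [0, j) and [t - j, t), the second with its lower end written additively to avoid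
  -- truncated subtraction.
  Range : ℕ → Bool → ℕ → ℕ → Set
  Range t true  j x = x < j
  Range t false j x = t ≤ x + j

  InBlock : ℕ → Bool → ℕ → ℕ → (Bool × ℕ) × ℕ → Set
  InBlock t c k j (v , x) = v ≡ (c , k) × x < t × Range t c j x

  InLog : ℕ → ℕ → (Bool × ℕ) × ℕ → Set
  InLog t n ((c , k) , x) = k < n × x < t × Range t c (load k) x

  optBlock-inBlock : ∀ t c k j → j ≤ t → All (InBlock t c k j) (optBlock t c k j)
  optBlock-inBlock t c     k zero    j≤t = []
  optBlock-inBlock t true  k (suc j) j<t = (refl , j<t , ≤-refl) ∷
    All.map (λ (v≡ , x<t , r) → v≡ , x<t , m<n⇒m<1+n r)
      (optBlock-inBlock t true k j (<⇒≤ j<t))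
  optBlock-inBlock t false k (suc j) j<t =
    (refl , ∸-monoʳ-< (s≤s z≤n) j<t , ≤-reflexive (sym (m∸n+n≡m j<t))) ∷
    All.map (λ {(_ , x)} (v≡ , x<t , r) → v≡ , x<t , ≤-trans r (+-monoʳ-≤ x (n≤1+n j)))
      (optBlock-inBlock t false k j (<⇒≤ j<t))

  optBlock-compatible : ∀ t c k j → j ≤ t → AllPairs (Compatible graph) (optBlock t c k j)
  optBlock-compatible t c     k zero    j≤t = []
  optBlock-compatible t true  k (suc j) j<t =
    All.map (λ (_ , _ , x<j) _ j≡x → <-irrefl (sym j≡x) x<j) (optBlock-inBlock t true k j (<⇒≤ j<t))
    ∷ optBlock-compatible t true k j (<⇒≤ j<t)
  optBlock-compatible t false k (suc j) j<t =
    -- The head `t ∸ suc j` lies just below the range of the tail: adding `j` to it gives less than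
    -- `t`.
    All.map (λ { (_ , _ , t≤x+j) _ refl → <-irrefl refl
        (<-≤-trans (≤-trans (+-monoʳ-< (t ∸ suc j) (n<1+n j)) (≤-reflexive (m∸n+n≡m j<t))) t≤x+j) })
      (optBlock-inBlock t false k j (<⇒≤ j<t))
    ∷ optBlock-compatible t false k j (<⇒≤ j<t)

  -- A common frequency would make the initial segment of length `load j` overlap the final segment
  -- of length `load k` inside [0, `time m`). Then the loads sum to more than `time m`, which the
  -- edge condition forbids.
  opposite-compatible : ∀ {m j k x y} → j ≤ m → k ≤ m → x < load j → time m ≤ y + load k →
    load j + load k ≤ time (j ⊔ k) → x ≢ y
  opposite-compatible {m} {j} {k} {x} j≤m k≤m x<l t≤ l≤t refl = <-irrefl refl (begin-strict
    time m            ≤⟨ t≤ ⟩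
    x + load k        <⟨ +-monoˡ-< (load k) x<l ⟩
    load j + load k   ≤⟨ l≤t ⟩
    time (j ⊔ k)      ≤⟨ time-mono (⊔-lub j≤m k≤m) ⟩
    time m            ∎)
    where open ≤-Reasoning

  InLog-compatible : ∀ {m} p q → InLog (time m) (suc m) p → InLog (time m) (suc m) q →
    proj₁ p ≢ proj₁ q → Compatible graph p q
  InLog-compatible _ _ _ _ v≢w (inj₁ v≡w) = contradiction v≡w v≢w
  InLog-compatible ((true , _) , _)  ((true , _) , _)  _ _ _ (inj₂ (c≢c , _)) = contradiction refl c≢c
  InLog-compatible ((false , _) , _) ((false , _) , _) _ _ _ (inj₂ (c≢c , _)) = contradiction refl c≢c
  InLog-compatible ((true , j) , _) ((false , k) , _) (j<m , _ , x<l) (k<m , _ , t≤) _ (inj₂ (_ , l≤t)) =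
    opposite-compatible (≤-pred j<m) (≤-pred k<m) x<l t≤ l≤t
  InLog-compatible ((false , j) , _) ((true , k) , _) (j<m , _ , t≤) (k<m , _ , x<l) _ (inj₂ e) =
    opposite-compatible (≤-pred k<m) (≤-pred j<m) x<l t≤ (proj₂ (E-sym graph {false , j} {true , k} e)) ∘ sym

  InBlock⇒InLog : ∀ {t c k n} → k < n → ∀ {p} → InBlock t c k (load k) p → InLog t n p
  InBlock⇒InLog k<n (refl , x<t , r) = k<n , x<t , r

  InLog-weaken : ∀ {t n n′} → n ≤ n′ → ∀ {p} → InLog t n p → InLog t n′ p
  InLog-weaken n≤n′ (k<n , r) = <-≤-trans k<n n≤n′ , r

  module _ (m : ℕ) where

    lastBlock : ∀ {n} → n ≤ m → ∀ c → All (InBlock (time m) c n (load n)) (optBlock (time m) c n (load n))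
    lastBlock {n} n≤m c = optBlock-inBlock (time m) c n (load n) (≤-trans (load≤time n) (time-mono n≤m))

    optLog-inLog : ∀ n → n ≤ suc m → All (InLog (time m) n) (optLog (time m) n)
    optLog-inLog zero    n≤ = []
    optLog-inLog (suc n) (s≤s n≤m) = All.++⁺
      (All.++⁺ (All.map (InLog-weaken (n≤1+n n)) (optLog-inLog n (m≤n⇒m≤1+n n≤m)))
               (All.map (InBlock⇒InLog (n<1+n n)) (lastBlock n≤m true)))
      (All.map (InBlock⇒InLog (n<1+n n)) (lastBlock n≤m false))

    optLog-compatible : ∀ n → n ≤ suc m → AllPairs (Compatible graph) (optLog (time m) n)
    optLog-compatible zero    n≤ = []
    optLog-compatible (suc n) (s≤s n≤m) = AllPairs.++⁺
      (AllPairs.++⁺ (optLog-compatible n n≤1+m)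
                    (inside true)
                    (All.map (λ {p} → vs-block true p) (optLog-inLog n n≤1+m)))
      (inside false)
      (All.++⁺ (All.map (λ {p} → vs-block false p) (optLog-inLog n n≤1+m))
               (All.map (λ {p} ip → All.map (λ {q} iq →
                   InLog-compatible p q (in-log ip) (in-log iq)
                     (λ v≡w → true≢false (trans (sym (proj₁ ip)) (trans v≡w (proj₁ iq)))))
                 (lastBlock n≤m false))
                 (lastBlock n≤m true)))
      where
      n≤1+m : n ≤ suc m
      n≤1+m = m≤n⇒m≤1+n n≤m

      inside : ∀ c → AllPairs (Compatible graph) (optBlock (time m) c n (load n))
      inside c = optBlock-compatible (time m) c n (load n) (≤-trans (load≤time n) (time-mono n≤m))

      in-log : ∀ {c p} → InBlock (time m) c n (load n) p → InLog (time m) (suc m) p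
      in-log = InBlock⇒InLog (s≤s n≤m)

      true≢false : _≢_ {A = Bool × ℕ} (true , n) (false , n)
      true≢false ()

      vs-block : ∀ c p → InLog (time m) n p →
        All (Compatible graph p) (optBlock (time m) c n (load n))
      -- The two entries sit at different vertices because `p` comes from a step below `n` and `q`
      -- from step `n` itself.
      vs-block c p ip = All.map (λ {q} iq →
          InLog-compatible p q (InLog-weaken n≤1+m ip) (in-log iq)
            (λ v≡w → <-irrefl (cong proj₂ (trans v≡w (proj₁ iq))) (proj₁ ip)))
        (lastBlock n≤m c)

    -- Witnesses opt ≤ `time m` at the end of step `m`. The allocation is built anew for each `m`,
    -- since side `false` counts down from `time m`.
    optAllocation : ∃ λ f → IsAllocation graph (requests (suc m)) f × #freqs f ≤ time m
    optAllocation = subst (λ rs → ∃ λ (f : Fin (length rs) → ℕ) → IsAllocation graph rs f × #freqs f ≤ time m)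
      (optLog-requests (time m) (suc m))
      ( assignment graph opt
      , assignment-isAllocation graph opt (optLog-compatible (suc m) ≤-refl)
      , subst (λ xs → length (deduplicate _≟_ xs) ≤ time m) (sym (tabulate-assignment graph opt))
          (length-deduplicate-≤ (time m) (map proj₂ opt)
            (All.map⁺ (All.map (λ il → proj₁ (proj₂ il)) (optLog-inLog (suc m) ≤-refl)))) )
      where opt = optLog (time m) (suc m)

  -- The algorithm's answers to the adversary

  module Play (A : IncrementalAlgorithm) (valid : IsValidAlgorithm A) where

    past : Bool → ℕ → List (Bool × ℕ)
    past true  k = requests k
    past false k = requests k ++ block true k

    blockLog : Bool → ℕ → List ((Bool × ℕ) × ℕ)
    blockLog c k = log (A graph) (past c k) (block c k)

    playLog : ℕ → List ((Bool × ℕ) × ℕ)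
    playLog n = runLog A graph (requests n)

    S : Bool → ℕ → List ℕ
    S c k = map proj₂ (blockLog c k)

    -- Steps count from 0, so the frequencies used through step k form `U (suc k)`.
    U : ℕ → List ℕ
    U n = map proj₂ (playLog n)

    playLog-suc : ∀ n → playLog (suc n) ≡ (playLog n ++ blockLog true n) ++ blockLog false n
    playLog-suc n = trans (log-++ (A graph) [] (past false n) (block false n))
      (cong (_++ blockLog false n) (log-++ (A graph) [] (requests n) (block true n)))

    length-S : ∀ c k → length (S c k) ≡ load k
    length-S c k = begin
      length (S c k)         ≡⟨ length-map proj₂ (blockLog c k) ⟩
      length (blockLog c k)  ≡⟨ length-log (A graph) (past c k) (block c k) ⟩
      length (block c k)     ≡⟨ length-replicate (load k) ⟩
      load k                 ∎
      where open ≡-Reasoning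

    blockLog⊆playLog : ∀ c k {p} → p ∈ blockLog c k → p ∈ playLog (suc k)
    blockLog⊆playLog true  k p∈ = subst (_ ∈_) (sym (playLog-suc k)) (∈-++⁺ˡ (∈-++⁺ʳ (playLog k) p∈))
    blockLog⊆playLog false k p∈ = subst (_ ∈_) (sym (playLog-suc k)) (∈-++⁺ʳ (playLog k ++ blockLog true k) p∈)

    playLog-mono : ∀ {m n p} → m ≤ n → p ∈ playLog m → p ∈ playLog n
    playLog-mono m≤n = mono (≤⇒≤′ m≤n)
      where
      mono : ∀ {m n p} → m ≤′ n → p ∈ playLog m → p ∈ playLog n
      mono ≤′-refl           p∈ = p∈
      mono (≤′-step {n} m≤n) p∈ = subst (_ ∈_) (sym (playLog-suc n)) (∈-++⁺ˡ (∈-++⁺ˡ (mono m≤n p∈)))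

    S⇒playLog : ∀ c {k n x} → k < n → x ∈ S c k → ((c , k) , x) ∈ playLog n
    S⇒playLog c {k} k<n x∈ = playLog-mono k<n
      (blockLog⊆playLog c k (∈-log-replicate (A graph) (past c k) (load k) (c , k) x∈))

    S⊆U : ∀ c {k n x} → k < n → x ∈ S c k → x ∈ U n
    S⊆U c k<n x∈ = ∈-map⁺ proj₂ (S⇒playLog c k<n x∈)

    U-mono : ∀ {m n x} → m ≤ n → x ∈ U m → x ∈ U n
    U-mono m≤n x∈ with p , p∈ , refl ← ∈-map⁻ proj₂ x∈ = ∈-map⁺ proj₂ (playLog-mono m≤n p∈)

    S-disjoint : ∀ {j k} → load j + load k ≤ time (j ⊔ k) → ∀ {x} → x ∈ S true j → x ∉ S false k
    -- Both blocks are in the log once step `j ⊔ k` is over, so the conflict is read off there.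
    S-disjoint {j} {k} l≤t x∈j x∈k = runLog-conflict A graph valid (requests (suc (j ⊔ k)))
      (S⇒playLog true (s≤s (m≤m⊔n j k)) x∈j)
      (S⇒playLog false (s≤s (m≤n⊔m j k)) x∈k)
      ((λ ()) , l≤t) refl

    S-unique : ∀ c k → Unique (S c k)
    -- The block's log is a suffix of the full run on `past c k ++ block c k`, and all its entries
    -- sit at one vertex.
    S-unique c k = freqs-unique (past c k) (load k) (AllPairs-++⁻ʳ (runLog A graph (past c k))
      (subst (AllPairs (Compatible graph)) (log-++ (A graph) [] (past c k) (block c k))
        (runLog-compatible A graph valid (past c k ++ block c k))))
      where
      freqs-unique : ∀ vs n → AllPairs (Compatible graph) (log (A graph) vs (replicate n (c , k))) →
        Unique (map proj₂ (log (A graph) vs (replicate n (c , k))))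
      freqs-unique vs zero    _        = []
      freqs-unique vs (suc n) (h ∷ cs) =
        All.tabulate (λ y∈ → All.lookup h (∈-log-replicate (A graph) (vs ∷ʳ (c , k)) n (c , k) y∈) (inj₁ refl))
        ∷ freqs-unique (vs ∷ʳ (c , k)) n cs

    -- The optimum is kept as some `k ≤ time m`: the sign of `R` is unknown, so `k` cannot yet be
    -- raised to `time m` in `R * k`.
    U-competitive : ∀ R (comp : IsCompetitive R A) → ∀ m →
      ∃ λ k → k ≤ time m × ℕ→ℚ (length (deduplicate _≟_ (U (suc m)))) ℚ.≤ R ℚ.* ℕ→ℚ k ℚ.+ proj₁ comp
    U-competitive R (c , comp) m = let f , alloc , f≤t = optAllocation m in
      #freqs f , f≤t ,
      subst (λ u → ℕ→ℚ u ℚ.≤ R ℚ.* ℕ→ℚ (#freqs f) ℚ.+ c) (#freqs-run A graph (requests (suc m)))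
        (comp graph (requests (suc m)) f alloc)

-- The combinatorial inequality

all-Bool? : ∀ {P : Bool → Set} → (∀ b → Dec (P b)) → Dec (∀ b → P b)
all-Bool? P? = map′ (λ { (f , t) false → f ; (f , t) true → t }) (λ p → p false , p true)
  (P? false ×-dec P? true)

shared : Bool → Bool → Bool → Bool → Bool
shared a b c d = (a ∧ b) ∨ (c ∧ d)

-- Counts Z_s by its side-`true` members alone, which yields |Z_s| ≤ 2s.
shared≤ : ∀ a b c d → 𝟙 (shared a b c d) ≤ 𝟙 a + 𝟙 c
shared≤ = from-yes (all-Bool? λ a → all-Bool? λ b → all-Bool? λ c → all-Bool? λ d →
  𝟙 (shared a b c d) ≤? 𝟙 a + 𝟙 c)

-- In the notation of the header, a, b / c, d / e, f are membership in the sets with labels (s , s),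
-- (3s/2 , s), (2s , s); primes refer to 2s; u and w are membership in U_{2s} and U_{3s}.
-- Each disjointness or inclusion follows its last variable so that the exhaustive check prunes early.
pointwise :
  ∀ e b → e ∧ b ≡ false → ∀ d → e ∧ d ≡ false → ∀ f → e ∧ f ≡ false →
  ∀ a → a ∧ f ≡ false → ∀ c → c ∧ f ≡ false →
  ∀ c′ → c′ ∧ b ≡ false → c′ ∧ d ≡ false → c′ ∧ f ≡ false →
  ∀ d′ → a ∧ d′ ≡ false → c ∧ d′ ≡ false → e ∧ d′ ≡ false →
  ∀ u → a ∧ not u ≡ false → c ∧ not u ≡ false → e ∧ not u ≡ false → f ∧ not u ≡ false →
  ∀ w → u ∧ not w ≡ false → c′ ∧ not w ≡ false → d′ ∧ not w ≡ false →
  ∀ a′ → a′ ∧ not u ≡ false → ∀ b′ → b′ ∧ not u ≡ false →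
  (𝟙 (shared a b c d) + 𝟙 (shared a b c d)) + ((𝟙 e + 𝟙 f) + ((𝟙 a′ + 𝟙 b′) + (𝟙 c′ + 𝟙 d′)))
    ≤ (𝟙 u + 𝟙 u) + (𝟙 w + 𝟙 (shared a′ b′ c′ d′))
pointwise = from-yes (
  all-Bool? λ e → all-Bool? λ b → ∅? (e ∧ b) →-dec all-Bool? λ d → ∅? (e ∧ d) →-dec
  all-Bool? λ f → ∅? (e ∧ f) →-dec all-Bool? λ a → ∅? (a ∧ f) →-dec all-Bool? λ c → ∅? (c ∧ f) →-dec
  all-Bool? λ c′ → ∅? (c′ ∧ b) →-dec ∅? (c′ ∧ d) →-dec ∅? (c′ ∧ f) →-dec
  all-Bool? λ d′ → ∅? (a ∧ d′) →-dec ∅? (c ∧ d′) →-dec ∅? (e ∧ d′) →-dec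
  all-Bool? λ u → ∅? (a ∧ not u) →-dec ∅? (c ∧ not u) →-dec ∅? (e ∧ not u) →-dec ∅? (f ∧ not u) →-dec
  all-Bool? λ w → ∅? (u ∧ not w) →-dec ∅? (c′ ∧ not w) →-dec ∅? (d′ ∧ not w) →-dec
  all-Bool? λ a′ → ∅? (a′ ∧ not u) →-dec all-Bool? λ b′ → ∅? (b′ ∧ not u) →-dec
  (𝟙 (shared a b c d) + 𝟙 (shared a b c d)) + ((𝟙 e + 𝟙 f) + ((𝟙 a′ + 𝟙 b′) + (𝟙 c′ + 𝟙 d′)))
    ≤? (𝟙 u + 𝟙 u) + (𝟙 w + 𝟙 (shared a′ b′ c′ d′)))
  where
  ∅? : ∀ x → Dec (x ≡ false)
  ∅? x = x Boolₚ.≟ false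

-- The doubling schedule

module Doubling (m : ℕ) where

  h : ℕ → ℕ
  h zero    = m
  h (suc i) = 2 * h i

  m≤h : ∀ i → m ≤ h i
  m≤h zero    = ≤-refl
  m≤h (suc i) = ≤-trans (m≤h i) (m≤m+n (h i) (h i + 0))

  -- The recursion by threes makes `time (suc i * 3)` reduce to `2 * time (i * 3)`. The last step of
  -- a level and the first step of the next share the time 4h = 2s but carry loads s and 2s.
  time : ℕ → ℕ
  time 0                   = 2 * m
  time 1                   = 3 * m
  time 2                   = 4 * m
  time (suc (suc (suc k))) = 2 * time k

  load : ℕ → ℕ
  load 0                   = 2 * m
  load 1                   = 2 * m
  load 2                   = 2 * m
  load (suc (suc (suc k))) = 2 * load k

  double : ∀ {x} r h → x ≡ r * h → 2 * x ≡ r * (2 * h)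
  double r h refl = swap r h
    where
    swap : ∀ r h → 2 * (r * h) ≡ r * (2 * h)
    swap = solve-∀

  time₀ : ∀ i → time (i * 3) ≡ 2 * h i
  time₀ zero    = refl
  time₀ (suc i) = double 2 (h i) (time₀ i)

  time₁ : ∀ i → time (1 + i * 3) ≡ 3 * h i
  time₁ zero    = refl
  time₁ (suc i) = double 3 (h i) (time₁ i)

  time₂ : ∀ i → time (2 + i * 3) ≡ 4 * h i
  time₂ zero    = refl
  time₂ (suc i) = double 4 (h i) (time₂ i)

  load₀ : ∀ i → load (i * 3) ≡ 2 * h i
  load₀ zero    = refl
  load₀ (suc i) = double 2 (h i) (load₀ i)

  load₁ : ∀ i → load (1 + i * 3) ≡ 2 * h i
  load₁ zero    = refl
  load₁ (suc i) = double 2 (h i) (load₁ i)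

  load₂ : ∀ i → load (2 + i * 3) ≡ 2 * h i
  load₂ zero    = refl
  load₂ (suc i) = double 2 (h i) (load₂ i)

  time-suc : ∀ k → time k ≤ time (suc k)
  time-suc 0                   = *-monoˡ-≤ m (n≤1+n 2)
  time-suc 1                   = *-monoˡ-≤ m (n≤1+n 3)
  time-suc 2                   = ≤-reflexive (*-assoc 2 2 m)
  time-suc (suc (suc (suc k))) = *-monoʳ-≤ 2 (time-suc k)

  time-mono : ∀ {j k} → j ≤ k → time j ≤ time k
  time-mono = mono ∘ ≤⇒≤′
    where
    mono : ∀ {j k} → j ≤′ k → time j ≤ time k
    mono ≤′-refl           = ≤-refl
    mono (≤′-step {k} j≤k) = ≤-trans (mono j≤k) (time-suc k)

  load≤time : ∀ k → load k ≤ time k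
  load≤time 0                   = ≤-refl
  load≤time 1                   = *-monoˡ-≤ m (n≤1+n 2)
  load≤time 2                   = *-monoˡ-≤ m (m≤m+n 2 2)
  load≤time (suc (suc (suc k))) = *-monoʳ-≤ 2 (load≤time k)

  -- The edge condition is tight: s + s = 2s. It is applied to all three steps of level `i`,
  -- including the last one against its own counterpart.
  adjacent-sameLevel : ∀ i {k} → load k ≡ 2 * h i → load k + load (2 + i * 3) ≤ time (2 + i * 3)
  adjacent-sameLevel i lk = ≤-reflexive
    (trans (cong₂ _+_ lk (load₂ i)) (trans (sum4 (h i)) (sym (time₂ i))))
    where
    sum4 : ∀ h → 2 * h + 2 * h ≡ 4 * h
    sum4 = solve-∀

  -- Step `4 + i * 3` is the middle step of the next level, with load 2s at time 3s, so the edge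
  -- condition is again tight: s + 2s = 3s.
  adjacent-nextLevel : ∀ i {k} → load k ≡ 2 * h i → load k + load (4 + i * 3) ≤ time (4 + i * 3)
  adjacent-nextLevel i lk = ≤-reflexive
    (trans (cong₂ _+_ lk (load₁ (suc i))) (trans (sum6 (h i)) (sym (time₁ (suc i)))))
    where
    sum6 : ∀ h → 2 * h + 2 * (2 * h) ≡ 3 * (2 * h)
    sum6 = solve-∀

-- Arithmetic of one doubling

-- The hypothesis amounts to 7bu ≤ (10b - 1)k + 7bC, whose coefficient of k is nonnegative whatever
-- the sign of R was.
weaken-optimum : ∀ b u C {k t} .{{_ : NonZero b}} → k ≤ t →
  7 * b * u + k ≤ 10 * b * k + 7 * b * C → 7 * b * u + t ≤ 10 * b * t + 7 * b * C
weaken-optimum b u C {k} {t} k≤t bound = begin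
  7 * b * u + t                              ≡⟨ cong₂ _+_ (refl {x = 7 * b * u}) (m+[n∸m]≡n k≤t) ⟨
  7 * b * u + (k + (t ∸ k))                  ≡⟨ +-assoc (7 * b * u) k (t ∸ k) ⟨
  7 * b * u + k + (t ∸ k)                    ≤⟨ +-mono-≤ bound (m≤n*m (t ∸ k) (10 * b)) ⟩
  10 * b * k + 7 * b * C + 10 * b * (t ∸ k)  ≡⟨ regroup b C k (t ∸ k) ⟩
  10 * b * (k + (t ∸ k)) + 7 * b * C         ≡⟨ cong (λ t → 10 * b * t + 7 * b * C) (m+[n∸m]≡n k≤t) ⟩
  10 * b * t + 7 * b * C                     ∎
  where
  open ≤-Reasoning
  instance _ = m*n≢0 10 b
  regroup : ∀ b C k d → 10 * b * k + 7 * b * C + 10 * b * d ≡ 10 * b * (k + d) + 7 * b * C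
  regroup = solve-∀

-- Two bounds at time 4h and one at 6h total 14h, against 20h requests: this is the ratio 10/7.
-- After multiplication by 7b the terms 140bh cancel and the slack 2 · 4h + 6h = 14h survives;
-- division by 7 leaves the gain 2h.
level-arithmetic : ∀ b C z z′ h u w →
  (z + z) + 20 * h ≤ (u + u) + (w + z′) →
  7 * b * u + 4 * h ≤ 10 * b * (4 * h) + 7 * b * C →
  7 * b * w + 6 * h ≤ 10 * b * (6 * h) + 7 * b * C →
  2 * b * z + 2 * h ≤ 3 * b * C + b * z′
level-arithmetic b C z z′ h u w level≤ u≤ w≤ = *-cancelˡ-≤ 7 (+-cancelˡ-≤ (140 * b * h) _ _ (begin
  140 * b * h + 7 * (2 * b * z + 2 * h)                          ≡⟨ regroup₁ b h z ⟩
  7 * b * ((z + z) + 20 * h) + 14 * h                            ≤⟨ +-monoˡ-≤ (14 * h) (*-monoʳ-≤ (7 * b) level≤) ⟩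
  7 * b * ((u + u) + (w + z′)) + 14 * h                          ≡⟨ regroup₂ b h u w z′ ⟩
  2 * (7 * b * u + 4 * h) + (7 * b * w + 6 * h) + 7 * b * z′      ≤⟨ +-monoˡ-≤ (7 * b * z′) (+-mono-≤ (*-monoʳ-≤ 2 u≤) w≤) ⟩
  2 * (10 * b * (4 * h) + 7 * b * C) + (10 * b * (6 * h) + 7 * b * C) + 7 * b * z′ ≡⟨ regroup₃ b h C z′ ⟩
  140 * b * h + 7 * (3 * b * C + b * z′)                          ∎))
  where
  open ≤-Reasoning
  regroup₁ : ∀ b h z → 140 * b * h + 7 * (2 * b * z + 2 * h) ≡ 7 * b * ((z + z) + 20 * h) + 14 * h
  regroup₁ = solve-∀
  regroup₂ : ∀ b h u w z → 7 * b * ((u + u) + (w + z)) + 14 * h ≡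
    2 * (7 * b * u + 4 * h) + (7 * b * w + 6 * h) + 7 * b * z
  regroup₂ = solve-∀
  regroup₃ : ∀ b h C z → 2 * (10 * b * (4 * h) + 7 * b * C) + (10 * b * (6 * h) + 7 * b * C) + 7 * b * z ≡
    140 * b * h + 7 * (3 * b * C + b * z)
  regroup₃ = solve-∀

-- Growth of Z along the doublings

module Growth (m : ℕ) (S : Bool → ℕ → List ℕ) (U : ℕ → List ℕ)
  (length-S   : ∀ c k → length (S c k) ≡ Doubling.load m k)
  (S-unique   : ∀ c k → Unique (S c k))
  (S-disjoint : ∀ {j k} → Doubling.load m j + Doubling.load m k ≤ Doubling.time m (j ⊔ k) →
                ∀ {x} → x ∈ S true j → x ∉ S false k)
  (S⊆U        : ∀ c {k n x} → k < n → x ∈ S c k → x ∈ U n)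
  (U-mono     : ∀ {k n x} → k ≤ n → x ∈ U k → x ∈ U n)
  where

  open Doubling m

  S-disjointˡ : ∀ {j k} → load j + load k ≤ time k → ∀ x → (x ∈ᵇ S true j) ∧ (x ∈ᵇ S false k) ≡ false
  S-disjointˡ {j} {k} l≤t x = ∈ᵇ-disjoint x {S true j} {S false k}
    (S-disjoint (≤-trans l≤t (time-mono (m≤n⊔m j k))))

  S-disjointʳ : ∀ {j k} → load j + load k ≤ time k → ∀ x → (x ∈ᵇ S true k) ∧ (x ∈ᵇ S false j) ≡ false
  S-disjointʳ {j} {k} l≤t x = ∈ᵇ-disjoint x {S true k} {S false j}
    (S-disjoint (≤-trans (≤-reflexive (+-comm (load k) (load j))) (≤-trans l≤t (time-mono (m≤m⊔n k j)))))

  S⊆ᵇU : ∀ c k {n} → k < n → ∀ x → (x ∈ᵇ S c k) ∧ not (x ∈ᵇ U n) ≡ false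
  S⊆ᵇU c k {n} k<n x = ∈ᵇ-⊆ x {S c k} {U n} (S⊆U c k<n)

  -- This is Z_s for s = 2 * h i: steps r + i * 3, r = 0, 1, 2, have load s and times s, 3s/2, 2s.
  Z : ℕ → ℕ → Bool
  Z i x = shared (x ∈ᵇ S true (i * 3)) (x ∈ᵇ S false (i * 3))
                 (x ∈ᵇ S true (1 + i * 3)) (x ∈ᵇ S false (1 + i * 3))

  -- If x ∈ Z_s, adjacency keeps x out of the sets labelled (2s, s) and (3s, 2s), while A + B ≤ 1 +
  -- Z_{2s} at (2s, 2s). If x ∉ Z_s, the disjoint (2s, s) sets cost at most U_{2s}, and the pairs at
  -- (2s, 2s) and (3s, 2s) cost at most U_{2s} and U_{3s}, plus one for each pair sharing x. If both
  -- pairs share x, Z_{2s} pays only once, but then the (2s, s) sets miss x.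
  level-pointwise : ∀ i x → let n = i * 3 in
    (𝟙 (Z i x) + 𝟙 (Z i x)) +
      ((𝟙 (x ∈ᵇ S true (2 + n)) + 𝟙 (x ∈ᵇ S false (2 + n))) +
       ((𝟙 (x ∈ᵇ S true (3 + n)) + 𝟙 (x ∈ᵇ S false (3 + n))) +
        (𝟙 (x ∈ᵇ S true (4 + n)) + 𝟙 (x ∈ᵇ S false (4 + n)))))
    ≤ (𝟙 (x ∈ᵇ U (4 + n)) + 𝟙 (x ∈ᵇ U (4 + n))) + (𝟙 (x ∈ᵇ U (5 + n)) + 𝟙 (Z (suc i) x))
  level-pointwise i x = pointwise
    (s true 2)
    (s false 0) (S-disjointʳ {n} same₀ x)
    (s false 1) (S-disjointʳ {1 + n} same₁ x)
    (s false 2) (S-disjointˡ {2 + n} same₂ x)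
    (s true 0)  (S-disjointˡ {n} same₀ x)
    (s true 1)  (S-disjointˡ {1 + n} same₁ x)
    (s true 4)  (S-disjointʳ {n} next₀ x) (S-disjointʳ {1 + n} next₁ x) (S-disjointʳ {2 + n} next₂ x)
    (s false 4) (S-disjointˡ {n} next₀ x) (S-disjointˡ {1 + n} next₁ x) (S-disjointˡ {2 + n} next₂ x)
    -- `U (4 + n)` ends with step `3 + n` at time 2s, and `U (5 + n)` with step `4 + n` at time 3s.
    (x ∈ᵇ U (4 + n))
      (S⊆ᵇU true n (m≤n+m (1 + n) 3) x) (S⊆ᵇU true (1 + n) (m≤n+m (2 + n) 2) x)
      (S⊆ᵇU true (2 + n) (n≤1+n (3 + n)) x) (S⊆ᵇU false (2 + n) (n≤1+n (3 + n)) x)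
    (x ∈ᵇ U (5 + n))
      (∈ᵇ-⊆ x {U (4 + n)} {U (5 + n)} (U-mono (n≤1+n (4 + n))))
      (S⊆ᵇU true (4 + n) ≤-refl x) (S⊆ᵇU false (4 + n) ≤-refl x)
    (s true 3)  (S⊆ᵇU true (3 + n) ≤-refl x)
    (s false 3) (S⊆ᵇU false (3 + n) ≤-refl x)
    where
    n = i * 3
    -- Offsets 0, 1, 2 carry the labels (s, s), (3s/2, s), (2s, s); offsets 3, 4 carry (2s, 2s),
    -- (3s, 2s).
    s : Bool → ℕ → Bool
    s c r = x ∈ᵇ S c (r + n)
    same₀ = adjacent-sameLevel i {n} (load₀ i)
    same₁ = adjacent-sameLevel i {1 + n} (load₁ i)
    same₂ = adjacent-sameLevel i {2 + n} (load₂ i)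
    next₀ = adjacent-nextLevel i {n} (load₀ i)
    next₁ = adjacent-nextLevel i {1 + n} (load₁ i)
    next₂ = adjacent-nextLevel i {2 + n} (load₂ i)

  #U : ℕ → ℕ
  #U k = length (deduplicate _≟_ (U k))

  module Count (N n : ℕ) (U<N : All (_< N) (U n)) where

    ∣S∣ : ∀ c k → k < n → ∣ _∈ᵇ S c k ∣< N ≡ load k
    ∣S∣ c k k<n = trans
      (∣Unique∣ N (S-unique c k) (All.tabulate (λ x∈ → All.lookup U<N (S⊆U c k<n x∈))))
      (length-S c k)

    ∣U∣ : ∀ k → k ≤ n → ∣ _∈ᵇ U k ∣< N ≡ #U k
    ∣U∣ k k≤n = ∣deduplicate∣ N (U k) (All.tabulate (λ x∈ → All.lookup U<N (U-mono k≤n x∈)))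

    ∣Z∣ : ℕ → ℕ
    ∣Z∣ i = ∣ Z i ∣< N

    ∣Z∣≤ : ∀ i → 1 + i * 3 < n → ∣Z∣ i ≤ 4 * h i
    ∣Z∣≤ i i<n = begin
      ∣Z∣ i
        ≤⟨ Σ<-mono N (λ x → shared≤ (x ∈ᵇ S true (i * 3)) (x ∈ᵇ S false (i * 3))
                                    (x ∈ᵇ S true (1 + i * 3)) (x ∈ᵇ S false (1 + i * 3))) ⟩
      Σ< N (λ x → 𝟙 (x ∈ᵇ S true (i * 3)) + 𝟙 (x ∈ᵇ S true (1 + i * 3)))
        ≡⟨ Σ<-+ N _ _ ⟩
      ∣ _∈ᵇ S true (i * 3) ∣< N + ∣ _∈ᵇ S true (1 + i * 3) ∣< N
        ≡⟨ cong₂ _+_ (trans (∣S∣ true (i * 3) (<⇒≤ i<n)) (load₀ i))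
                     (trans (∣S∣ true (1 + i * 3) i<n) (load₁ i)) ⟩
      2 * h i + 2 * h i
        ≡⟨ *-distribʳ-+ (h i) 2 2 ⟨
      4 * h i ∎
      where open ≤-Reasoning

    level : ∀ i → 4 + i * 3 < n →
      (∣Z∣ i + ∣Z∣ i) + 20 * h i ≤
      (#U (4 + i * 3) + #U (4 + i * 3)) + (#U (5 + i * 3) + ∣Z∣ (suc i))
    level i i<n = begin
      (∣Z∣ i + ∣Z∣ i) + 20 * h i
        -- 20h is the total size of two sets of size s = 2h and four of size 2s = 4h.
        ≡⟨ cong₂ _+_ (refl {x = ∣Z∣ i + ∣Z∣ i}) (sum20 (h i)) ⟩
      (∣Z∣ i + ∣Z∣ i) + ((2 * h i + 2 * h i) +
        ((2 * h (suc i) + 2 * h (suc i)) + (2 * h (suc i) + 2 * h (suc i))))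
        ≡⟨ cong₂ _+_ (refl {x = ∣Z∣ i + ∣Z∣ i}) (cong₂ _+_ (pair (2 + k) (load₂ i) (<⇒≤ (<⇒≤ i<n)))
             (cong₂ _+_ (pair (3 + k) (load₀ (suc i)) (<⇒≤ i<n)) (pair (4 + k) (load₁ (suc i)) i<n))) ⟨
      Σ< N z + Σ< N z + (Σ< N (s true 2) + Σ< N (s false 2) +
        ((Σ< N (s true 3) + Σ< N (s false 3)) + (Σ< N (s true 4) + Σ< N (s false 4))))
        ≡⟨ cong₂ _+_ (Σ<-+ N z z) (trans (Σ<-+ N _ _) (cong₂ _+_ (Σ<-+ N (s true 2) (s false 2))
             (trans (Σ<-+ N _ _) (cong₂ _+_ (Σ<-+ N (s true 3) (s false 3)) (Σ<-+ N (s true 4) (s false 4)))))) ⟨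
      Σ< N (λ x → z x + z x) + Σ< N (λ x → (s true 2 x + s false 2 x) +
        ((s true 3 x + s false 3 x) + (s true 4 x + s false 4 x)))
        ≡⟨ Σ<-+ N _ _ ⟨
      Σ< N (λ x → (z x + z x) + ((s true 2 x + s false 2 x) +
        ((s true 3 x + s false 3 x) + (s true 4 x + s false 4 x))))
        ≤⟨ Σ<-mono N (level-pointwise i) ⟩
      Σ< N (λ x → (u 4 x + u 4 x) + (u 5 x + z′ x))
        ≡⟨ trans (Σ<-+ N _ _) (cong₂ _+_ (Σ<-+ N (u 4) (u 4)) (Σ<-+ N (u 5) z′)) ⟩
      (Σ< N (u 4) + Σ< N (u 4)) + (Σ< N (u 5) + ∣Z∣ (suc i))
        ≡⟨ cong₂ (λ x y → (x + x) + (y + ∣Z∣ (suc i))) (∣U∣ (4 + k) (<⇒≤ i<n)) (∣U∣ (5 + k) i<n) ⟩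
      _ ∎
      where
      open ≤-Reasoning
      k = i * 3
      z z′ : ℕ → ℕ
      z x = 𝟙 (Z i x)
      z′ x = 𝟙 (Z (suc i) x)
      s : Bool → ℕ → ℕ → ℕ
      s c r x = 𝟙 (x ∈ᵇ S c (r + k))
      u : ℕ → ℕ → ℕ
      u r x = 𝟙 (x ∈ᵇ U (r + k))
      sum20 : ∀ h → 20 * h ≡ (2 * h + 2 * h) + ((2 * (2 * h) + 2 * (2 * h)) + (2 * (2 * h) + 2 * (2 * h)))
      sum20 = solve-∀
      pair : ∀ j {l} → load j ≡ l → j < n → ∣ _∈ᵇ S true j ∣< N + ∣ _∈ᵇ S false j ∣< N ≡ l + l
      pair j refl j<n = cong₂ _+_ (∣S∣ true j j<n) (∣S∣ false j j<n)

  module Bounded (b C : ℕ) (3bC<m : 3 * b * C < m)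
    (#U≤ : ∀ k → 7 * b * #U (suc k) + time k ≤ 10 * b * time k + 7 * b * C) where

    #U≤′ : ∀ k {t} → time k ≡ t → 7 * b * #U (suc k) + t ≤ 10 * b * t + 7 * b * C
    #U≤′ k refl = #U≤ k

    module _ (I : ℕ) where

      -- The inequality for level `I` reaches step `4 + I * 3`, hence 5 + 3I steps; the cutoff is
      -- one above every frequency used in them.
      n = 5 + I * 3
      open Count (suc (max 0 (U n))) n (All.map s≤s (xs≤max 0 (U n)))

      -- Of the gain 2h, one h pays for the additive error 3bC < m ≤ h and the other remains.
      step : ∀ i → i ≤ I → 2 * b * ∣Z∣ i + h i ≤ b * ∣Z∣ (suc i)
      step i i≤I = +-cancelˡ-≤ (h i) _ _ (begin
        h i + (2 * b * ∣Z∣ i + h i)    ≡⟨ regroup (h i) (2 * b * ∣Z∣ i) ⟩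
        2 * b * ∣Z∣ i + 2 * h i        ≤⟨ level-arithmetic b C (∣Z∣ i) (∣Z∣ (suc i)) (h i) _ _
                                            (level i (+-monoʳ-≤ 5 (*-monoˡ-≤ 3 i≤I)))
                                            (#U≤′ (3 + i * 3) (trans (time₀ (suc i)) (sym (*-assoc 2 2 (h i)))))
                                            (#U≤′ (4 + i * 3) (trans (time₁ (suc i)) (sym (*-assoc 3 2 (h i))))) ⟩
        3 * b * C + b * ∣Z∣ (suc i)    ≤⟨ +-monoˡ-≤ (b * ∣Z∣ (suc i)) (≤-trans (<⇒≤ 3bC<m) (m≤h i)) ⟩
        h i + b * ∣Z∣ (suc i)          ∎)
        where
        open ≤-Reasoning
        regroup : ∀ h x → h + (x + h) ≡ x + 2 * h
        regroup = solve-∀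

      -- For y_i = 2b|Z_i| / h_i, `step` says y_{i+1} ≥ y_i + 1, because h doubles from one level to
      -- the next.
      growth : ∀ i → i ≤ I → i * h i ≤ 2 * b * ∣Z∣ i
      growth zero    _   = z≤n
      growth (suc i) i<I = begin
        suc i * (2 * h i)            ≡⟨ regroup i (h i) ⟩
        2 * (i * h i + h i)          ≤⟨ *-monoʳ-≤ 2 (+-monoˡ-≤ (h i) (growth i (<⇒≤ i<I))) ⟩
        2 * (2 * b * ∣Z∣ i + h i)    ≤⟨ *-monoʳ-≤ 2 (step i (<⇒≤ i<I)) ⟩
        2 * (b * ∣Z∣ (suc i))        ≡⟨ *-assoc 2 b (∣Z∣ (suc i)) ⟨
        2 * b * ∣Z∣ (suc i)          ∎
        where
        open ≤-Reasoning
        regroup : ∀ i h → suc i * (2 * h) ≡ 2 * (i * h + h)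
        regroup = solve-∀

      levels-bounded : I ≤ 8 * b
      levels-bounded = *-cancelʳ-≤ I (8 * b) (h I) (begin
        I * h I              ≤⟨ growth I ≤-refl ⟩
        2 * b * ∣Z∣ I        ≤⟨ *-monoʳ-≤ (2 * b) (∣Z∣≤ I (m≤n+m (2 + I * 3) 3)) ⟩
        2 * b * (4 * h I)    ≡⟨ regroup b (h I) ⟩
        8 * b * h I          ∎)
        where
        open ≤-Reasoning
        -- Cancelling `h I` is legitimate since 0 < `m` ≤ `h I`.
        instance _ = >-nonZero (<-≤-trans (m<n⇒0<n 3bC<m) (m≤h I))
        regroup : ∀ b h → 2 * b * (4 * h) ≡ 8 * b * h
        regroup = solve-∀

-- The contradiction below 10/7

¬competitive : ∀ R A → IsValidAlgorithm A → IsCompetitive R A → ¬ (R ℚ.< + 10 ℚ./ 7)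
-- The bound 8b holds for any number of levels, so playing 8b + 1 of them refutes it.
¬competitive R A valid comp R<10/7 = 1+n≰n (levels-bounded (suc (8 * b)))
  where
  b = ↧ₙ R
  C = ℤ.∣ ↥ proj₁ comp ∣
  -- The smallest scale that exceeds the additive error 3bC already at level 0.
  m = suc (3 * b * C)
  open Doubling m
  open Adversary time load time-mono load≤time
  open Play A valid
  open Growth m S U length-S S-unique S-disjoint S⊆U U-mono

  #U≤ : ∀ k → 7 * b * #U (suc k) + time k ≤ 10 * b * time k + 7 * b * C
  #U≤ k = let opt , opt≤ , bound = U-competitive R comp k in
    weaken-optimum b (#U (suc k)) C opt≤ (clear-denominators R (proj₁ comp) (#U (suc k)) opt R<10/7 bound)

  open Bounded b C ≤-refl #U≤

theorem2 : (R : ℚ) (A : IncrementalAlgorithm) → IsValidAlgorithm A → IsCompetitive R A →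
    (+ 10) ℚ./ 7 ℚ.≤ R
theorem2 R A valid comp = ℚₚ.≮⇒≥ (¬competitive R A valid comp)
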